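{- Let $G$ be a countable group, and identify the power set $\mathbf{P}_G$ with $\{0,1\}^G$ (via characteristic functions) carrying the product topology. Then, as subsets of $\mathbf{P}_G$: the family $\mathbf{L}_G$ of large subsets is $F_\sigma$; the family $\mathbf{T}_G$ of thick subsets is $G_\delta$; the family $\mathbf{PT}_G$ of prethick subsets is $G_{\delta\sigma}$; and the families $\mathbf{S}_G$ of small subsets and $\mathbf{EL}_G$ of extralarge subsets are $F_{\sigma\delta}$.
   Context: Let $G$ be a group and $\mathcal{F}_G$ the family of finite subsets of $G$. A subset $A\subseteq G$ is large if $G=FA$ for some $F\in\mathcal{F}_G$; small if $L\setminus A$ is large for every large $L\subseteq G$; extralarge if $G\setminus A$ is small; thick if for every $F\in\mathcal{F}_G$ there is $a\in A$ with $Fa\subseteq A$; prethick if $FA$ is thick for some $F\in\mathcal{F}_G$. The topology on $\mathbf{P}_G$ has as subbase the sets $\{X: K\subseteq X\}$ and $\{X: X\cap K=\emptyset\}$ for finite $K\subseteq G$. -}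

module Defs where

open import Algebra.Bundles using (Group)
open import Data.Bool.Base using (Bool; true)
open import Data.List.Base using (List)
open import Data.List.Relation.Unary.All using (All)
open import Data.List.Relation.Unary.Any using (Any)
open import Data.Nat.Base using (ℕ)
open import Data.Product.Base using (Σ-syntax; ∃-syntax; _×_)
open import Function.Bundles using (Func; Surjection)
open import Level using (_⊔_; suc)
open import Relation.Binary.Bundles using (Setoid)
open import Relation.Binary.PropositionalEquality using (_≡_; setoid)
open import Relation.Unary
  using (Pred; _∈_; _⊆_; _≐_; ∁; _∖_; ⋃; ⋂; Universal)

-- Finite sets are allowed.  The empty setoid is excluded, which is harmless
-- for the carrier of a group.
Countable : ∀ {c ℓ} → Setoid c ℓ → Set (c ⊔ ℓ)
Countable S = Surjection (setoid ℕ) S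

-- Closure of a class of sets under countable unions (σ) and countable
-- intersections (δ).
module _ {x m r} {X : Set x} (𝒞 : Pred (Pred X m) r) where

  σ : Pred (Pred X m) (x ⊔ suc m ⊔ r)
  σ S = ∃[ C ] ((n : ℕ) → C n ∈ 𝒞) × S ≐ ⋃ ℕ C

  δ : Pred (Pred X m) (x ⊔ suc m ⊔ r)
  δ S = ∃[ C ] ((n : ℕ) → C n ∈ 𝒞) × S ≐ ⋂ ℕ C

-- The topology generated by a subbase B: the finite intersections of members
-- of B (the empty one being the whole space) form a base.
module Topology {x i s} {X : Set x} {I : Set i} (B : I → Pred X s) where

  Basic : List I → Pred X (i ⊔ s)
  Basic is x = All (λ i → x ∈ B i) is

  Open : ∀ {m} → Pred (Pred X m) (x ⊔ i ⊔ s ⊔ m)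
  Open U = ∀ {x} → x ∈ U → ∃[ is ] x ∈ Basic is × Basic is ⊆ U

  -- Constructively, asking instead that ∁ C be open would be a different
  -- condition.
  Closed : ∀ {m} → Pred (Pred X m) (x ⊔ i ⊔ s ⊔ suc m)
  Closed {m} C = Σ[ U ∈ Pred X m ] Open U × C ≐ ∁ U

  Fσ Gδ Gδσ Fσδ : ∀ {m} → Pred (Pred X m) (x ⊔ i ⊔ s ⊔ suc m)
  Fσ  = σ Closed
  Gδ  = δ Open
  Gδσ = σ Gδ
  Fσδ = δ Fσ

module Subsets {c ℓ} (G : Group c ℓ) where

  open Group G renaming (setoid to G-setoid)

  -- Finite subsets of G, given by listing their elements (in any order,
  -- possibly with repetitions).
  𝓕 : Set c
  𝓕 = List Carrier

  -- The power set of G, identified with {0,1}^G via characteristic functions.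
  𝐏 : Set (c ⊔ ℓ)
  𝐏 = Func G-setoid (setoid Bool)

  ⟦_⟧ : 𝐏 → Pred Carrier _
  ⟦ A ⟧ g = Func.to A g ≡ true

  infixr 8 _·_

  _·_ : ∀ {a} → 𝓕 → Pred Carrier a → Pred Carrier (c ⊔ ℓ ⊔ a)
  (F · A) g = Any (λ f → ∃[ a ] a ∈ A × g ≈ f ∙ a) F

  Large : ∀ {a} → Pred Carrier a → Set (c ⊔ ℓ ⊔ a)
  Large A = ∃[ F ] Universal (F · A)

  Small : ∀ {a} → Pred Carrier a → Set (c ⊔ ℓ ⊔ a)
  Small A = (L : 𝐏) → Large ⟦ L ⟧ → Large (⟦ L ⟧ ∖ A)

  ExtraLarge : ∀ {a} → Pred Carrier a → Set (c ⊔ ℓ ⊔ a)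
  ExtraLarge A = Small (∁ A)

  Thick : ∀ {a} → Pred Carrier a → Set (c ⊔ a)
  Thick A = (F : 𝓕) → ∃[ a ] a ∈ A × All (λ f → f ∙ a ∈ A) F

  Prethick : ∀ {a} → Pred Carrier a → Set (c ⊔ ℓ ⊔ a)
  Prethick A = ∃[ F ] Thick (F · A)

  𝐋 𝐒 𝐄𝐋 𝐏𝐓 : Pred 𝐏 (c ⊔ ℓ)
  𝐋  X = Large ⟦ X ⟧
  𝐒  X = Small ⟦ X ⟧
  𝐄𝐋 X = ExtraLarge ⟦ X ⟧
  𝐏𝐓 X = Prethick ⟦ X ⟧

  𝐓 : Pred 𝐏 c
  𝐓 X = Thick ⟦ X ⟧

  data Subbasic : Set c where
    contains avoids : 𝓕 → Subbasic

  -- The sets {X ∣ K ⊆ X} and {X ∣ X ∩ K = ∅} for finite K.  For singletons K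
  -- these are the cylinders {X ∣ X(g) = b}, and the others are finite
  -- intersections of cylinders, so they generate the product topology on
  -- {0,1}^G.
  subbase : Subbasic → Pred 𝐏 c
  subbase (contains K) X = All ⟦ X ⟧ K
  subbase (avoids K)   X = All (∁ ⟦ X ⟧) K

  open Topology subbase public

{-# OPTIONS --safe #-}

-- Three facts turn the five definitions into Borel conditions.  Membership of
-- a fixed g in F · X only involves the finitely many values X(f⁻¹g), so it is
-- decided on a neighbourhood of X.  By monotonicity, quantifiers over finite
-- subsets can be restricted to the initial segments of an enumeration of G.
-- Finally, the quantifier over all large L in the definition of smallness is
-- eliminated: A is small iff G ∖ F A is large for every finite F.  Indeed, small
-- sets are closed under translations and finite unions; conversely, if G = F L
-- then G ∖ F A ⊆ F (L ∖ A).
module Submission where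

open import Defs
open import Algebra.Bundles using (Group)
open import Data.Bool.Base using (true; false)
open import Data.Bool.Properties using (_≟_)
open import Data.List.Base
  using ([]; _∷_; [_]; _++_; map; applyUpTo; cartesianProductWith)
open import Data.List.Extrema.Nat using (max; xs≤max)
open import Data.List.Relation.Unary.All as All using (All; []; _∷_)
open import Data.List.Relation.Unary.All.Properties as All using ()
open import Data.List.Relation.Unary.Any as Any using (Any; here; there)
open import Data.List.Relation.Unary.Any.Properties as Any using ()
open import Data.Nat.Base using (ℕ; suc; s≤s)
open import Data.Product.Base using (∃-syntax; _×_; _,_; proj₁; proj₂)
open import Data.Sum.Base using (_⊎_; inj₁; inj₂)
open import Function.Base using (_∘_)
open import Function.Bundles using (Func; Surjection; mk⇔)
open import Relation.Binary.Definitions using (_Respects_)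
open import Relation.Binary.PropositionalEquality as ≡ using ()
open import Relation.Nullary.Decidable
  using (yes; no; does; does-⇔; dec-true; map′; decidable-stable; ¬?; _×-dec_)
open import Relation.Nullary.Negation using (contradiction)
open import Relation.Unary using (Pred; Decidable; Universal; _∈_; _⊆_; _≐_; ∁; _∖_; _∩_; ⋃)

-- Open and clopen sets of a topology given by a subbase.

module Clopens {x i s} {X : Set x} {I : Set i} (B : I → Pred X s) where

  open Topology B

  module _ {m n} {P : Pred X m} {Q : Pred X n} where

    Open-∩ : Open P → Open Q → Open (P ∩ Q)
    Open-∩ P-open Q-open (p , q) with P-open p | Q-open q
    ... | is , x∈is , is⊆P | js , x∈js , js⊆Q =
      is ++ js , All.++⁺ x∈is x∈js ,
      λ y∈ → is⊆P (All.++⁻ˡ is y∈) , js⊆Q (All.++⁻ʳ is y∈)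

  module _ {k m} {K : Set k} {P : K → Pred X m} where

    Open-⋃ : (∀ k → Open (P k)) → Open (⋃ K P)
    Open-⋃ P-open (k , p) with P-open k p
    ... | is , x∈is , is⊆P = is , x∈is , λ y∈ → k , is⊆P y∈

    Open-All : (∀ k → Open (P k)) → ∀ ks → Open (λ x → All (λ k → x ∈ P k) ks)
    Open-All P-open []       []       = [] , [] , λ _ → []
    Open-All P-open (k ∷ ks) (p ∷ ps)
      with P-open k p | Open-All P-open ks ps
    ... | is , x∈is , is⊆P | js , x∈js , js⊆Ps =
      is ++ js , All.++⁺ x∈is x∈js ,
      λ y∈ → is⊆P (All.++⁻ˡ is y∈) ∷ js⊆Ps (All.++⁻ʳ is y∈)

  -- Constructively stronger than P and ∁ P both being open, as P is moreover
  -- decidable.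
  Clopen : ∀ {m} → Pred (Pred X m) _
  Clopen P = ∀ x → ∃[ is ] x ∈ Basic is × (Basic is ⊆ P ⊎ Basic is ⊆ ∁ P)

  module _ {m} {P : Pred X m} where

    Clopen⇒Decidable : Clopen P → Decidable P
    Clopen⇒Decidable P-clopen x with P-clopen x
    ... | _ , x∈is , inj₁ is⊆P  = yes (is⊆P x∈is)
    ... | _ , x∈is , inj₂ is⊆∁P = no (is⊆∁P x∈is)

    Clopen⇒Open : Clopen P → Open P
    Clopen⇒Open P-clopen {x} p with P-clopen x
    ... | is , x∈is , inj₁ is⊆P  = is , x∈is , is⊆P
    ... | is , x∈is , inj₂ is⊆∁P = contradiction p (is⊆∁P x∈is)

    Clopen-∁ : Clopen P → Clopen (∁ P)
    Clopen-∁ P-clopen x with P-clopen x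
    ... | is , x∈is , inj₁ is⊆P  = is , x∈is , inj₂ λ y∈ ¬p → ¬p (is⊆P y∈)
    ... | is , x∈is , inj₂ is⊆∁P = is , x∈is , inj₁ is⊆∁P

    Clopen-resp-≐ : ∀ {n} {Q : Pred X n} → P ≐ Q → Clopen P → Clopen Q
    Clopen-resp-≐ (P⊆Q , Q⊆P) P-clopen x with P-clopen x
    ... | is , x∈is , inj₁ is⊆P  = is , x∈is , inj₁ (P⊆Q ∘ is⊆P)
    ... | is , x∈is , inj₂ is⊆∁P = is , x∈is , inj₂ λ y∈ → is⊆∁P y∈ ∘ Q⊆P

  module _ {k m} {K : Set k} {P : K → Pred X m} (P-clopen : ∀ k → Clopen (P k)) where

    Clopen-Any : ∀ ks → Clopen (λ x → Any (λ k → x ∈ P k) ks)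
    Clopen-Any []       x = [] , [] , inj₂ λ _ ()
    Clopen-Any (k ∷ ks) x with P-clopen k x | Clopen-Any ks x
    ... | is , x∈is , inj₁ is⊆P  | _ = is , x∈is , inj₁ (here ∘ is⊆P)
    ... | _ | js , x∈js , inj₁ js⊆Ps = js , x∈js , inj₁ (there ∘ js⊆Ps)
    ... | is , x∈is , inj₂ is⊆∁P | js , x∈js , inj₂ js⊆∁Ps =
      is ++ js , All.++⁺ x∈is x∈js , inj₂ λ where
        y∈ (here p)   → is⊆∁P (All.++⁻ˡ is y∈) p
        y∈ (there ps) → js⊆∁Ps (All.++⁻ʳ is y∈) ps

module _ {c ℓ} (G : Group c ℓ) where

  open Group G renaming (setoid to G-setoid)
  open import Algebra.Properties.Group G
    using (\\-leftDividesˡ; \\-leftDividesʳ; y≈x\\z)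
  open import Data.List.Membership.Setoid.Properties using (∈-applyUpTo⁺; ∈-resp-≈)
  open import Data.List.Relation.Binary.Subset.Setoid G-setoid
    using () renaming (_⊆_ to _⊆ᶠ_)
  open import Data.List.Relation.Binary.Subset.Setoid.Properties
    using (Any-resp-⊆; All-resp-⊇)
  open Subsets G
  open Clopens subbase

  -- Products of a finite set with a set, and transfer of largeness.

  ⟦⟧-resp : (X : 𝐏) → ⟦ X ⟧ Respects _≈_
  ⟦⟧-resp X g≈h g∈X = ≡.trans (≡.sym (Func.cong X g≈h)) g∈X

  ∁-resp : ∀ {a} {A : Pred Carrier a} → A Respects _≈_ → ∁ A Respects _≈_
  ∁-resp A-resp g≈h g∉A h∈A = g∉A (A-resp (sym g≈h) h∈A)

  module _ {a} {A : Pred Carrier a} where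

    ·-resp : ∀ F → (F · A) Respects _≈_
    ·-resp F g≈h = Any.map λ (a , a∈A , g≈fa) → a , a∈A , trans (sym g≈h) g≈fa

    ·-monoˡ : ∀ {F H} → F ⊆ᶠ H → F · A ⊆ H · A
    ·-monoˡ F⊆H = Any-resp-⊆ G-setoid
      (λ f≈h (a , a∈A , g≈fa) → a , a∈A , trans g≈fa (∙-congʳ f≈h)) F⊆H

    ·-assoc : ∀ F H → F · (H · A) ⊆ cartesianProductWith _∙_ F H · A
    ·-assoc (f ∷ F) H (here (b , b∈HA , g≈fb)) = Any.++⁺ˡ (Any.map⁺ (Any.map
      (λ (a , a∈A , b≈ha) → a , a∈A ,
        trans g≈fb (trans (∙-congˡ b≈ha) (sym (assoc _ _ _)))) b∈HA))
    ·-assoc (f ∷ F) H (there g∈FHA) = Any.++⁺ʳ (map (f ∙_) H) (·-assoc F H g∈FHA)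

    -- The witness `a` is forced to be f⁻¹g. Hence membership of g in `F · A` is a finite
    -- disjunction of membership conditions on `A`.
    ∈-translate⁺ : A Respects _≈_ → ∀ {f g} → ∃[ a ] a ∈ A × g ≈ f ∙ a → f \\ g ∈ A
    ∈-translate⁺ A-resp (a , a∈A , g≈fa) = A-resp (y≈x\\z _ _ _ (sym g≈fa)) a∈A

    ∈-translate⁻ : ∀ {f g} → f \\ g ∈ A → ∃[ a ] a ∈ A × g ≈ f ∙ a
    ∈-translate⁻ f\\g∈A = _ , f\\g∈A , sym (\\-leftDividesˡ _ _)

    ·-decidable : A Respects _≈_ → Decidable A → ∀ F → Decidable (F · A)
    ·-decidable A-resp A? F g =
      Any.any? (λ f → map′ ∈-translate⁻ (∈-translate⁺ A-resp) (A? (f \\ g))) F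

  ·-monoʳ : ∀ {a b} {A : Pred Carrier a} {B : Pred Carrier b} F →
            A ⊆ B → F · A ⊆ F · B
  ·-monoʳ F A⊆B = Any.map λ (a , a∈A , g≈fa) → a , A⊆B a∈A , g≈fa

  module _ {a b} {A : Pred Carrier a} {B : Pred Carrier b} where

    -- If G = HA and A ⊆ FB, then G = (HF)B. Monotonicity, translation and both directions of the
    -- smallness criterion go through this.
    Large-⊆· : ∀ F → A ⊆ F · B → Large A → Large B
    Large-⊆· F A⊆FB (H , G≡HA) =
      cartesianProductWith _∙_ H F , λ g → ·-assoc H F (·-monoʳ H A⊆FB (G≡HA g))

    Large-mono : A ⊆ B → Large A → Large B
    Large-mono A⊆B = Large-⊆· [ ε ] λ {g} g∈A → here (g , A⊆B g∈A , sym (identityˡ g))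

    Thick-mono : A ⊆ B → Thick A → Thick B
    Thick-mono A⊆B A-thick F with A-thick F
    ... | a , a∈A , Fa⊆A = a , A⊆B a∈A , All.map A⊆B Fa⊆A

  Large-translate : ∀ {a} {A : Pred Carrier a} → A Respects _≈_ → ∀ f →
                    Large A → Large (λ g → f ∙ g ∈ A)
  Large-translate A-resp f = Large-⊆· [ f ] λ {g} g∈A →
    here (∈-translate⁻ (A-resp (sym (\\-leftDividesˡ f g)) g∈A))

  -- Smallness in terms of the complements of `F · A`.

  module _ {a} {A : Pred Carrier a} (A-resp : A Respects _≈_) (A? : Decidable A) where

    -- `Small` tests only sets with a characteristic function, so a decidable set must be converted
    -- into one.
    indicator : 𝐏
    indicator = record
      { to   = λ g → does (A? g)
      ; cong = λ {g} {h} g≈h →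
          does-⇔ (mk⇔ (A-resp g≈h) (A-resp (sym g≈h))) (A? g) (A? h)
      }

    indicator⊆ : ⟦ indicator ⟧ ⊆ A
    indicator⊆ {g} eq with A? g
    ... | yes g∈A = g∈A

    ⊆indicator : A ⊆ ⟦ indicator ⟧
    ⊆indicator {g} g∈A = dec-true (A? g) g∈A

  module _ {a} {A : Pred Carrier a} (A-resp : A Respects _≈_) (A? : Decidable A) where

    -- Induction on `F`. What remains of `L` without `F · A` is a large set L′. Its translate f⁻¹L′
    -- is large and stays so once the small set `A` is removed; multiplying by f turns this into
    -- removing fA from L′.
    Small⇒Large-∖· : Small A → ∀ F (L : 𝐏) → Large ⟦ L ⟧ → Large (⟦ L ⟧ ∖ F · A)
    Small⇒Large-∖· A-small []      L L-large = Large-mono (λ g∈L → g∈L , λ ()) L-large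
    Small⇒Large-∖· A-small (f ∷ F) L L-large =
      -- The single element listed is f⁻¹, which undoes the multiplication by f.
      Large-⊆· [ f \\ ε ] back (A-small f⁻¹L′ f⁻¹L′-large)
      where
      L′ : Pred Carrier _
      L′ = ⟦ L ⟧ ∖ F · A

      L′-resp : L′ Respects _≈_
      L′-resp g≈h (g∈L , g∉FA) = ⟦⟧-resp L g≈h g∈L , ∁-resp (·-resp F) g≈h g∉FA

      f⁻¹L′-resp : (λ g → f ∙ g ∈ L′) Respects _≈_
      f⁻¹L′-resp = L′-resp ∘ ∙-congˡ

      f⁻¹L′? : Decidable (λ g → f ∙ g ∈ L′)
      f⁻¹L′? g = (Func.to L (f ∙ g) ≟ true) ×-dec ¬? (·-decidable A-resp A? F (f ∙ g))

      f⁻¹L′ : 𝐏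
      f⁻¹L′ = indicator f⁻¹L′-resp f⁻¹L′?

      f⁻¹L′-large : Large ⟦ f⁻¹L′ ⟧
      f⁻¹L′-large = Large-mono (⊆indicator f⁻¹L′-resp f⁻¹L′?)
        (Large-translate L′-resp f (Small⇒Large-∖· A-small F L L-large))

      back : ⟦ f⁻¹L′ ⟧ ∖ A ⊆ [ f \\ ε ] · (⟦ L ⟧ ∖ (f ∷ F) · A)
      back {g} (g∈f⁻¹L′ , g∉A) =
        here (f ∙ g , (proj₁ fg∈L′ , fg∉) ,
              sym (trans (∙-congʳ (identityʳ (f ⁻¹))) (\\-leftDividesʳ f g)))
        where
        fg∈L′ = indicator⊆ f⁻¹L′-resp f⁻¹L′? g∈f⁻¹L′

        fg∉ : f ∙ g ∈ ∁ ((f ∷ F) · A)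
        fg∉ (here fg∈fA)  = g∉A (A-resp (\\-leftDividesʳ f g) (∈-translate⁺ A-resp fg∈fA))
        fg∉ (there fg∈FA) = proj₂ fg∈L′ fg∈FA

    -- The case L = G.
    Small⇒Large-∁· : Small A → ∀ F → Large (∁ (F · A))
    Small⇒Large-∁· A-small F = Large-mono proj₂ (Small⇒Large-∖· A-small F 𝟙 𝟙-large)
      where
      𝟙 : 𝐏
      𝟙 = record { to = λ _ → true ; cong = λ _ → ≡.refl }

      𝟙-large : Large ⟦ 𝟙 ⟧
      𝟙-large = [ ε ] , λ g → here (g , ≡.refl , sym (identityˡ g))

    Large-∁·⇒Small : (∀ F → Large (∁ (F · A))) → Small A
    Large-∁·⇒Small ∁FA-large L (F , G≡FL) = Large-⊆· F ∁FA⊆F[L∖A] (∁FA-large F)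
      where
      ∁FA⊆F[L∖A] : ∁ (F · A) ⊆ F · (⟦ L ⟧ ∖ A)
      ∁FA⊆F[L∖A] {g} g∉FA = go F (G≡FL g) g∉FA
        where
        -- Write g = hl with l in `L`; if l were in `A`, then g would lie in `H · A`.
        go : ∀ H → g ∈ H · ⟦ L ⟧ → g ∈ ∁ (H · A) → g ∈ H · (⟦ L ⟧ ∖ A)
        go (h ∷ H) (here (l , l∈L , g≈hl)) g∉HA =
          here (l , (l∈L , λ l∈A → g∉HA (here (l , l∈A , g≈hl))) , g≈hl)
        go (h ∷ H) (there g∈HL) g∉HA = there (go H g∈HL (g∉HA ∘ there))

  -- Clopen membership conditions.

  Clopen-∈ : ∀ g → Clopen (λ X → g ∈ ⟦ X ⟧)
  -- One subbasic set, for the singleton of g, fixes the value of `X` at g.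
  Clopen-∈ g X with Func.to X g in eq
  ... | true  = [ contains [ g ] ] , (eq ∷ []) ∷ [] , inj₁ (All.head ∘ All.head)
  ... | false = [ avoids [ g ] ] , (g∉X ∷ []) ∷ [] , inj₂ (All.head ∘ All.head)
    where
    g∉X : g ∈ ∁ ⟦ X ⟧
    g∉X g∈X with () ← ≡.trans (≡.sym eq) g∈X

  Clopen-· : ∀ {a} {A : 𝐏 → Pred Carrier a} →
             (∀ X → A X Respects _≈_) → (∀ g → Clopen (λ X → g ∈ A X)) →
             ∀ F g → Clopen (λ X → g ∈ F · A X)
  Clopen-· A-resp A-clopen F g = Clopen-Any (λ f → Clopen-resp-≐
    (∈-translate⁻ , λ {X} → ∈-translate⁺ (A-resp X)) (A-clopen (f \\ g))) F

  -- Borel classes over a countable group.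

  module _ (G-countable : Countable G-setoid) where

    open Surjection G-countable using (to; to⁻; to∘to⁻)

    initial : ℕ → 𝓕
    initial = applyUpTo to

    initial-cofinal : ∀ F → ∃[ n ] F ⊆ᶠ initial n
    -- `N` bounds the indices of chosen preimages of the elements of `F`; the successor is needed
    -- because `initial n` stops before index n.
    initial-cofinal F = suc N , λ g∈F →
      All.lookupₛ G-setoid (∈-resp-≈ G-setoid)
        (All.map (λ {f} i≤N → ∈-resp-≈ G-setoid (to∘to⁻ f)
                   (∈-applyUpTo⁺ G-setoid to (s≤s i≤N)))
                 (All.map⁻ (xs≤max 0 (map to⁻ F))))
        g∈F
      where
      N : ℕ
      N = max 0 (map to⁻ F)

    module _ {a} {A : 𝐏 → Pred Carrier a} (A-resp : ∀ X → A X Respects _≈_)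
             (A-clopen : ∀ g → Clopen (λ X → g ∈ A X)) where

      -- For a fixed finite set the covering condition is an intersection of clopen conditions over
      -- g, hence closed. Letting `A` depend on `X` makes the lemma applicable to complements of
      -- `F · A X`.
      Large-Fσ : (λ X → Large (A X)) ∈ Fσ
      Large-Fσ = (λ n X → Universal (initial n · A X)) , closed ,
        (λ (F , G≡FA) → let n , F⊆ = initial-cofinal F in
          n , λ g → ·-monoˡ F⊆ (G≡FA g)) ,
        (λ (n , G≡FA) → initial n , G≡FA)
        where
        closed : ∀ n → Closed (λ X → Universal (initial n · A X))
        closed n = (λ X → ∃[ g ] g ∈ ∁ (initial n · A X)) ,
          Open-⋃ (λ g → Clopen⇒Open (Clopen-∁ (FA-clopen g))) ,
          (λ G≡FA (g , g∉FA) → g∉FA (G≡FA g)) ,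
          -- Lying outside the open set only says that no g is missed; decidability removes the
          -- double negation.
          (λ {X} ∄g g → decidable-stable (Clopen⇒Decidable (FA-clopen g) X)
            λ g∉FA → ∄g (g , g∉FA))
          where
          FA-clopen : ∀ g → Clopen (λ X → g ∈ initial n · A X)
          FA-clopen = Clopen-· A-resp A-clopen (initial n)

      -- For fixed `F`, the condition is a union over a of finite intersections of open sets, and it
      -- passes from `F` to its subsets.
      Thick-Gδ : (λ X → Thick (A X)) ∈ Gδ
      Thick-Gδ =
        (λ n X → ∃[ a ] a ∈ A X × All (λ f → f ∙ a ∈ A X) (initial n)) ,
        (λ n → Open-⋃ λ a → Open-∩ (∈-open a) (Open-All (λ f → ∈-open (f ∙ a)) (initial n))) ,
        (λ A-thick n → A-thick (initial n)) ,
        (λ {X} thick F → let n , F⊆ = initial-cofinal F; a , a∈A , Fa⊆A = thick n in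
          a , a∈A , All-resp-⊇ G-setoid (A-resp X ∘ ∙-congʳ) F⊆ Fa⊆A)
        where
        ∈-open : ∀ g → Open (λ X → g ∈ A X)
        ∈-open g = Clopen⇒Open (A-clopen g)

    module _ {a} {A : 𝐏 → Pred Carrier a} (A-resp : ∀ X → A X Respects _≈_)
             (A-clopen : ∀ g → Clopen (λ X → g ∈ A X)) where

      Prethick-Gδσ : (λ X → Prethick (A X)) ∈ Gδσ
      Prethick-Gδσ = (λ n X → Thick (initial n · A X)) ,
        (λ n → Thick-Gδ (λ X → ·-resp (initial n)) (Clopen-· A-resp A-clopen (initial n))) ,
        (λ (F , FA-thick) → let n , F⊆ = initial-cofinal F in
          n , Thick-mono (·-monoˡ F⊆) FA-thick) ,
        (λ (n , FA-thick) → initial n , FA-thick)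

      -- Enlarging `F` shrinks the complement of `F · A X`, so the smallness criterion need only be
      -- tested on initial segments.
      Small-Fσδ : (λ X → Small (A X)) ∈ Fσδ
      Small-Fσδ = (λ n X → Large (∁ (initial n · A X))) ,
        (λ n → Large-Fσ (λ X → ∁-resp (·-resp (initial n)))
          (λ g → Clopen-∁ (Clopen-· A-resp A-clopen (initial n) g))) ,
        (λ {X} A-small n → Small⇒Large-∁· (A-resp X) (A? X) A-small (initial n)) ,
        (λ {X} large → Large-∁·⇒Small (A-resp X) (A? X) λ F →
          let n , F⊆ = initial-cofinal F in Large-mono (λ g∉ → g∉ ∘ ·-monoˡ F⊆) (large n))
        where
        A? : ∀ X → Decidable (A X)
        A? X g = Clopen⇒Decidable (A-clopen g) X

theorem3p1 : ∀ {c ℓ} (G : Group c ℓ) → Countable (Group.setoid G) →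
    let open Subsets G in
    𝐋 ∈ Fσ × 𝐓 ∈ Gδ × 𝐏𝐓 ∈ Gδσ × 𝐒 ∈ Fσδ × 𝐄𝐋 ∈ Fσδ
theorem3p1 G countable =
  Large-Fσ     G countable (⟦⟧-resp G) (Clopen-∈ G) ,
  Thick-Gδ     G countable (⟦⟧-resp G) (Clopen-∈ G) ,
  Prethick-Gδσ G countable (⟦⟧-resp G) (Clopen-∈ G) ,
  Small-Fσδ    G countable (⟦⟧-resp G) (Clopen-∈ G) ,
  -- Extralargeness is smallness of the complement, and complements of clopen conditions are clopen.
  Small-Fσδ    G countable (∁-resp G ∘ ⟦⟧-resp G) (Clopens.Clopen-∁ _ ∘ Clopen-∈ G)
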